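{- Let $G$ be a finite bipartite graph of order $n$ (i.e. with $n$ vertices) without isolated vertices. Then $\gamma(G)=\gamma^{\infty}(G)$ if and only if $\gamma(G)=n/2$.
   Context: All graphs are finite, simple and undirected. A dominating set of $G=(V,E)$ is a set $D\subseteq V$ such that every vertex of $V-D$ is adjacent to a vertex of $D$; $\gamma(G)$ is the minimum size of a dominating set. Eternal domination ("one guard moves"): a defender chooses a set $D_1\subseteq V$ and places one guard on each vertex of $D_1$. Then, for $i=1,2,\ldots$ in turn, an attacker (knowing the current position) chooses a vertex $r_i\in V-D_i$, and the defender responds by moving exactly one guard to $r_i$ from an adjacent vertex $v\in D_i$, so that $D_{i+1}=(D_i-\{v\})\cup\{r_i\}$. Every $D_i$ must be a dominating set. $D_1$ is an eternal dominating set (EDS) if the defender, starting from $D_1$, can respond in this way forever to every infinite sequence of attacks. The eternal domination number $\gamma^{\infty}(G)$ is the minimum size of an EDS of $G$. -}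

module Defs where

open import Data.Bool using (Bool)
open import Data.Fin using (Fin)
open import Data.Fin.Subset using (Subset; _∈_; _∉_; _∪_; _-_; ⁅_⁆; ∣_∣)
open import Data.List using (List; []; _∷_)
open import Data.Nat using (ℕ; _≤_)
open import Data.Product using (Σ-syntax; ∃-syntax; _×_)
open import Data.Unit using (⊤)
open import Level using (0ℓ)
open import Relation.Binary using (Rel; Decidable; Symmetric; Irreflexive)
open import Relation.Binary.PropositionalEquality using (_≡_; _≢_)

record Graph (n : ℕ) : Set₁ where
  field
    _~_    : Rel (Fin n) 0ℓ
    _~?_   : Decidable _~_
    ~-sym  : Symmetric _~_
    ~-irr  : Irreflexive _≡_ _~_

-- The least size of a set satisfying P, as a relation: at most one k
-- satisfies it, and one exists (classically) as soon as some set satisfies P.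
IsMinimumSize : ∀ {n} → (Subset n → Set) → ℕ → Set
IsMinimumSize P k = (∃[ D ] (P D × ∣ D ∣ ≡ k)) × (∀ D → P D → k ≤ ∣ D ∣)

module _ {n : ℕ} (G : Graph n) where
  open Graph G

  -- The two colour classes may be empty.
  Bipartite : Set
  Bipartite = Σ[ c ∈ (Fin n → Bool) ] (∀ {u v} → u ~ v → c u ≢ c v)

  NoIsolatedVertices : Set
  NoIsolatedVertices = ∀ v → ∃[ u ] v ~ u

  Dominating : Subset n → Set
  Dominating D = ∀ v → v ∉ D → ∃[ u ] (u ∈ D × u ~ v)

  -- The number g satisfying this is γ(G).
  IsDominationNumber : ℕ → Set
  IsDominationNumber = IsMinimumSize Dominating

  -- The defender's choice may depend on all attacks so far: σ rs r is the
  -- vertex whose guard answers an attack on r after the earlier attacks rs,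
  -- which are listed most recent first.
  Strategy : Set
  Strategy = List (Fin n) → Fin n → Fin n

  -- The position reached from D₁ after the given attacks.
  position : Subset n → Strategy → List (Fin n) → Subset n
  position D₁ σ []       = D₁
  position D₁ σ (r ∷ rs) = (position D₁ σ rs - σ rs r) ∪ ⁅ r ⁆

  -- Every attack is on a vertex that is unoccupied when it is attacked.
  LegalAttacks : Subset n → Strategy → List (Fin n) → Set
  LegalAttacks D₁ σ []       = ⊤
  LegalAttacks D₁ σ (r ∷ rs) = LegalAttacks D₁ σ rs × r ∉ position D₁ σ rs

  LegalResponse : Subset n → Fin n → Fin n → Set
  LegalResponse D r v = v ∈ D × v ~ r

  -- Responding forever means that the rules hold after every finite sequence
  -- of legal attacks. Play stops only when no vertex is left to attack, so
  -- the set of all vertices is an eternal dominating set.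
  EternalDominating : Subset n → Set
  EternalDominating D₁ = Σ[ σ ∈ Strategy ] (∀ rs → LegalAttacks D₁ σ rs →
    let D = position D₁ σ rs in
    Dominating D × (∀ r → r ∉ D → LegalResponse D r (σ rs r)))

  -- The number e satisfying this is γ^∞(G).
  IsEternalDominationNumber : ℕ → Set
  IsEternalDominationNumber = IsMinimumSize EternalDominating

{-# OPTIONS --safe #-}

-- Let A be a colour class. Both A and its complement dominate, so γ is at most
-- the size of either. Attacking the vertices of an independent set one after
-- another fills it with guards, since a guard on it is not adjacent to the later
-- attacks; so γ^∞ is at least the size of either. Hence γ = γ^∞ forces both
-- classes to have γ vertices. Conversely, if 2γ = n then both classes have
-- γ vertices. For S ⊆ A the set (A ─ S) ∪ N(S) dominates, so minimality of |A|
-- is Hall's condition, and a perfect matching exists. Guards on A then defend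
-- forever by moving along matching edges.
module Submission where

open import Data.Bool using (true; false; if_then_else_)
open import Data.Bool.Properties using (¬-not)
open import Data.Fin using (Fin; _≟_)
open import Data.Fin.Properties using (any?)
open import Data.Fin.Subset
open import Data.Fin.Subset.Properties
open import Data.List using (List; []; _∷_; allFin)
open import Data.List.Membership.Propositional using () renaming (_∈_ to _∈ˡ_)
open import Data.List.Membership.Propositional.Properties using (∈-allFin)
open import Data.List.Relation.Unary.Any using (here; there)
open import Data.Nat using (ℕ; zero; suc; _+_; _*_; _≤_; _<_; z≤n; _<?_; _≤?_)
open import Data.Nat.Properties hiding (_≟_; _<?_; _≤?_)
open import Data.Product using (∃-syntax; _×_; _,_; proj₁; proj₂)
open import Data.Sum using (inj₁; inj₂; [_,_])
open import Data.Unit using (tt)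
open import Data.Vec using ([]; _∷_; here; there; tabulate)
open import Data.Vec.Properties using (lookup∘tabulate; []=⇒lookup; lookup⇒[]=)
open import Function using (_∘_; _⇔_; mk⇔)
open import Level using (0ℓ)
open import Relation.Nullary using (¬_; yes; no; does; contradiction)
open import Relation.Nullary.Decidable using (_×-dec_; dec-true; dec-false; decidable-stable)
open import Relation.Unary using (Pred; Decidable)
open import Relation.Binary.PropositionalEquality hiding ([_])
open import Defs

-- Cardinalities of finite subsets.

private variable
  n : ℕ
  p q r : Subset n

∣p∪q∣+∣p∩q∣≡∣p∣+∣q∣ : (p q : Subset n) → ∣ p ∪ q ∣ + ∣ p ∩ q ∣ ≡ ∣ p ∣ + ∣ q ∣
∣p∪q∣+∣p∩q∣≡∣p∣+∣q∣ [] [] = refl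
∣p∪q∣+∣p∩q∣≡∣p∣+∣q∣ (inside ∷ p) (inside ∷ q) = cong suc
  (trans (+-suc _ _) (trans (cong suc (∣p∪q∣+∣p∩q∣≡∣p∣+∣q∣ p q)) (sym (+-suc _ _))))
∣p∪q∣+∣p∩q∣≡∣p∣+∣q∣ (inside ∷ p) (outside ∷ q) = cong suc (∣p∪q∣+∣p∩q∣≡∣p∣+∣q∣ p q)
∣p∪q∣+∣p∩q∣≡∣p∣+∣q∣ (outside ∷ p) (inside ∷ q) =
  trans (cong suc (∣p∪q∣+∣p∩q∣≡∣p∣+∣q∣ p q)) (sym (+-suc _ _))
∣p∪q∣+∣p∩q∣≡∣p∣+∣q∣ (outside ∷ p) (outside ∷ q) = ∣p∪q∣+∣p∩q∣≡∣p∣+∣q∣ p q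

∣p∪q∣≤∣p∣+∣q∣ : (p q : Subset n) → ∣ p ∪ q ∣ ≤ ∣ p ∣ + ∣ q ∣
∣p∪q∣≤∣p∣+∣q∣ p q = m+n≤o⇒m≤o _ (≤-reflexive (∣p∪q∣+∣p∩q∣≡∣p∣+∣q∣ p q))

r⊆p∪q⇒∣r∣≤∣p∣+∣q∣ : (p q : Subset n) → r ⊆ p ∪ q → ∣ r ∣ ≤ ∣ p ∣ + ∣ q ∣
r⊆p∪q⇒∣r∣≤∣p∣+∣q∣ p q r⊆ = ≤-trans (p⊆q⇒∣p∣≤∣q∣ r⊆) (∣p∪q∣≤∣p∣+∣q∣ p q)

Empty⇒∣p∣≡0 : ∀ {n} {p : Subset n} → Empty p → ∣ p ∣ ≡ 0
Empty⇒∣p∣≡0 {n} e = trans (cong ∣_∣ (Empty-unique e)) (∣⊥∣≡0 n)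

0<∣p∣⇒Nonempty : 0 < ∣ p ∣ → Nonempty p
0<∣p∣⇒Nonempty {p = p} 0<∣p∣ =
  decidable-stable (nonempty? p) λ e → <⇒≢ 0<∣p∣ (sym (Empty⇒∣p∣≡0 e))

x∈p⇒⁅x⁆⊆p : ∀ {x} → x ∈ p → ⁅ x ⁆ ⊆ p
x∈p⇒⁅x⁆⊆p {p = p} {x} x∈p y∈ = subst (_∈ p) (sym (x∈⁅y⁆⇒x≡y x y∈)) x∈p

x∈p─q⇒x∉q : ∀ {x} (p q : Subset n) → x ∈ p ─ q → x ∉ q
x∈p─q⇒x∉q (_ ∷ p) (inside ∷ q) (there x∈) (there x∈q) = x∈p─q⇒x∉q p q x∈ x∈q
x∈p─q⇒x∉q (_ ∷ p) (outside ∷ q) (there x∈) (there x∈q) = x∈p─q⇒x∉q p q x∈ x∈q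

p⊆p─q∪q : (p q : Subset n) → p ⊆ (p ─ q) ∪ q
p⊆p─q∪q p q {x} x∈p with x ∈? q
... | yes x∈q = x∈p∪q⁺ (inj₂ x∈q)
... | no  x∉q = x∈p∪q⁺ (inj₁ (x∈p∧x∉q⇒x∈p─q x∈p x∉q))

p⊆r∧q⊆r⇒p∪q⊆r : p ⊆ r → q ⊆ r → p ∪ q ⊆ r
p⊆r∧q⊆r⇒p∪q⊆r p⊆r q⊆r x∈ = [ p⊆r , q⊆r ] (x∈p∪q⁻ _ _ x∈)

Disjoint : Subset n → Subset n → Set
Disjoint p q = ∀ {x} → x ∈ p → x ∉ q

Disjoint⇒∣p∣+∣q∣≤∣r∣ : Disjoint p q → p ⊆ r → q ⊆ r → ∣ p ∣ + ∣ q ∣ ≤ ∣ r ∣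
Disjoint⇒∣p∣+∣q∣≤∣r∣ {p = p} {q} {r} disj p⊆r q⊆r = begin
  ∣ p ∣ + ∣ q ∣         ≡⟨ ∣p∪q∣+∣p∩q∣≡∣p∣+∣q∣ p q ⟨
  ∣ p ∪ q ∣ + ∣ p ∩ q ∣ ≡⟨ cong (∣ p ∪ q ∣ +_) (Empty⇒∣p∣≡0 p∩q-empty) ⟩
  ∣ p ∪ q ∣ + 0         ≡⟨ +-identityʳ _ ⟩
  ∣ p ∪ q ∣             ≤⟨ p⊆q⇒∣p∣≤∣q∣ (p⊆r∧q⊆r⇒p∪q⊆r p⊆r q⊆r) ⟩
  ∣ r ∣                 ∎
  where
  open ≤-Reasoning
  p∩q-empty : Empty (p ∩ q)
  p∩q-empty (x , x∈) = disj (p∩q⊆p p q x∈) (p∩q⊆q p q x∈)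

q⊆p⇒∣p─q∣+∣q∣≤∣p∣ : q ⊆ p → ∣ p ─ q ∣ + ∣ q ∣ ≤ ∣ p ∣
q⊆p⇒∣p─q∣+∣q∣≤∣p∣ {q = q} {p} = Disjoint⇒∣p∣+∣q∣≤∣r∣ (x∈p─q⇒x∉q p q) (p─q⊆p p q)

∣p∣≤∣p─q∣+∣q∣ : (p q : Subset n) → ∣ p ∣ ≤ ∣ p ─ q ∣ + ∣ q ∣
∣p∣≤∣p─q∣+∣q∣ p q = r⊆p∪q⇒∣r∣≤∣p∣+∣q∣ (p ─ q) q (p⊆p─q∪q p q)

-- Subsets cut out by decidable predicates.

module _ {P : Pred (Fin n) 0ℓ} (P? : Decidable P) where

  comprehension : Subset n
  comprehension = tabulate (does ∘ P?)

  ∈-comprehension⁺ : ∀ {v} → P v → v ∈ comprehension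
  ∈-comprehension⁺ {v} Pv =
    lookup⇒[]= v _ (trans (lookup∘tabulate _ v) (dec-true (P? v) Pv))

  ∈-comprehension⁻ : ∀ {v} → v ∈ comprehension → P v
  ∈-comprehension⁻ {v} v∈ = decidable-stable (P? v) λ ¬Pv →
    contradiction
      (trans (sym (dec-false (P? v) ¬Pv)) (trans (sym (lookup∘tabulate _ v)) ([]=⇒lookup v∈)))
      λ ()

-- Neighbourhoods and perfect matchings.

module _ (G : Graph n) where
  open Graph G

  adjacentTo? : ∀ S → Decidable (λ v → ∃[ u ] (u ∈ S × u ~ v))
  adjacentTo? S v = any? (λ u → u ∈? S ×-dec u ~? v)

  N : Subset n → Subset n
  N S = comprehension (adjacentTo? S)

  ∈-N⁺ : ∀ {S u v} → u ∈ S → u ~ v → v ∈ N S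
  ∈-N⁺ {S} u∈S u~v = ∈-comprehension⁺ (adjacentTo? S) (_ , u∈S , u~v)

  ∈-N⁻ : ∀ {S v} → v ∈ N S → ∃[ u ] (u ∈ S × u ~ v)
  ∈-N⁻ {S} = ∈-comprehension⁻ (adjacentTo? S)

  N-mono : ∀ {S T} → S ⊆ T → N S ⊆ N T
  N-mono S⊆T v∈ = let u , u∈S , u~v = ∈-N⁻ v∈ in ∈-N⁺ (S⊆T u∈S) u~v

  -- `partner` is total on `Fin n` but constrained only on `W`, so matchings of different vertex
  -- sets can be combined by a plain case distinction.
  record PerfectMatchingOn (W : Subset n) : Set where
    field
      partner    : Fin n → Fin n
      partner-∈  : ∀ {v} → v ∈ W → partner v ∈ W
      adjacent   : ∀ {v} → v ∈ W → partner v ~ v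
      involutive : ∀ {v} → v ∈ W → partner (partner v) ≡ v

  open PerfectMatchingOn

  module _ {W₁ W₂ W : Subset n} (disj : Disjoint W₁ W₂) (W⊆W₁∪W₂ : W ⊆ W₁ ∪ W₂)
           (W₁⊆W : W₁ ⊆ W) (W₂⊆W : W₂ ⊆ W)
           (M₁ : PerfectMatchingOn W₁) (M₂ : PerfectMatchingOn W₂) where

    private
      f : Fin n → Fin n
      f v = if does (v ∈? W₁) then partner M₁ v else partner M₂ v

      f≡₁ : ∀ {v} → v ∈ W₁ → f v ≡ partner M₁ v
      f≡₁ {v} v∈ rewrite dec-true (v ∈? W₁) v∈ = refl

      f≡₂ : ∀ {v} → v ∈ W₂ → f v ≡ partner M₂ v
      f≡₂ {v} v∈ rewrite dec-false (v ∈? W₁) (λ v∈₁ → disj v∈₁ v∈) = refl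

      split : (P : Pred (Fin n) 0ℓ) → (∀ {v} → v ∈ W₁ → P v) → (∀ {v} → v ∈ W₂ → P v) →
              ∀ {v} → v ∈ W → P v
      split P P₁ P₂ v∈ = [ P₁ , P₂ ] (x∈p∪q⁻ W₁ W₂ (W⊆W₁∪W₂ v∈))

    glue : PerfectMatchingOn W
    glue .partner = f
    glue .partner-∈ = split (λ v → f v ∈ W)
      (λ v∈ → subst (_∈ W) (sym (f≡₁ v∈)) (W₁⊆W (partner-∈ M₁ v∈)))
      (λ v∈ → subst (_∈ W) (sym (f≡₂ v∈)) (W₂⊆W (partner-∈ M₂ v∈)))
    glue .adjacent = split (λ v → f v ~ v)
      (λ {v} v∈ → subst (_~ v) (sym (f≡₁ v∈)) (adjacent M₁ v∈))
      (λ {v} v∈ → subst (_~ v) (sym (f≡₂ v∈)) (adjacent M₂ v∈))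
    glue .involutive = split (λ v → f (f v) ≡ v)
      -- By `partner-∈` the partner stays in the same piece, so the second application of `f` takes
      -- the same branch as the first.
      (λ v∈ → trans (cong f (f≡₁ v∈)) (trans (f≡₁ (partner-∈ M₁ v∈)) (involutive M₁ v∈)))
      (λ v∈ → trans (cong f (f≡₂ v∈)) (trans (f≡₂ (partner-∈ M₂ v∈)) (involutive M₂ v∈)))

  emptyMatching : ∀ {W} → Empty W → PerfectMatchingOn W
  emptyMatching e = record
    { partner    = λ v → v
    ; partner-∈  = λ v∈ → contradiction (_ , v∈) e
    ; adjacent   = λ v∈ → contradiction (_ , v∈) e
    ; involutive = λ v∈ → contradiction (_ , v∈) e
    }

  edgeMatching : ∀ {x y} → x ~ y → PerfectMatchingOn (⁅ x ⁆ ∪ ⁅ y ⁆)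
  edgeMatching {x} {y} x~y = record
    { partner    = f
    ; partner-∈  = split (λ v → f v ∈ ⁅ x ⁆ ∪ ⁅ y ⁆)
        (subst (_∈ ⁅ x ⁆ ∪ ⁅ y ⁆) (sym fx≡y) (q⊆p∪q ⁅ x ⁆ ⁅ y ⁆ (x∈⁅x⁆ y)))
        (subst (_∈ ⁅ x ⁆ ∪ ⁅ y ⁆) (sym fy≡x) (p⊆p∪q ⁅ y ⁆ (x∈⁅x⁆ x)))
    ; adjacent   = split (λ v → f v ~ v)
        (subst (_~ x) (sym fx≡y) (~-sym x~y)) (subst (_~ y) (sym fy≡x) x~y)
    ; involutive = split (λ v → f (f v) ≡ v)
        (trans (cong f fx≡y) fy≡x) (trans (cong f fy≡x) fx≡y)
    }
    where
    f : Fin n → Fin n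
    -- Every vertex other than `x` goes to `x`; for `y` this is the intended branch because
    -- irreflexivity separates the ends of an edge.
    f v = if does (v ≟ x) then y else x

    fx≡y : f x ≡ y
    fx≡y rewrite dec-true (x ≟ x) refl = refl

    fy≡x : f y ≡ x
    fy≡x rewrite dec-false (y ≟ x) (λ y≡x → ~-irr (sym y≡x) x~y) = refl

    split : (P : Pred (Fin n) 0ℓ) → P x → P y → ∀ {v} → v ∈ ⁅ x ⁆ ∪ ⁅ y ⁆ → P v
    split P Px Py v∈ with x∈p∪q⁻ ⁅ x ⁆ ⁅ y ⁆ v∈
    ... | inj₁ v∈x = subst P (sym (x∈⁅y⁆⇒x≡y x v∈x)) Px
    ... | inj₂ v∈y = subst P (sym (x∈⁅y⁆⇒x≡y y v∈y)) Py

  -- The common shape of both cases of the Hall induction: `X₁` and `Y₁` are a tight set and its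
  -- neighbours in `Y`, or the two ends of one edge.
  glueDifferences : ∀ {X Y X₁ Y₁} → Disjoint X Y → X₁ ⊆ X → Y₁ ⊆ Y →
    PerfectMatchingOn (X₁ ∪ Y₁) → PerfectMatchingOn ((X ─ X₁) ∪ (Y ─ Y₁)) →
    PerfectMatchingOn (X ∪ Y)
  glueDifferences {X} {Y} {X₁} {Y₁} disj X₁⊆X Y₁⊆Y = glue disjoint cover
    (p⊆r∧q⊆r⇒p∪q⊆r (p⊆p∪q Y ∘ X₁⊆X) (q⊆p∪q X Y ∘ Y₁⊆Y))
    (p⊆r∧q⊆r⇒p∪q⊆r (p⊆p∪q Y ∘ p─q⊆p X X₁) (q⊆p∪q X Y ∘ p─q⊆p Y Y₁))
    where
    disjoint : Disjoint (X₁ ∪ Y₁) ((X ─ X₁) ∪ (Y ─ Y₁))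
    disjoint v∈₁ v∈₂ with x∈p∪q⁻ X₁ Y₁ v∈₁ | x∈p∪q⁻ (X ─ X₁) (Y ─ Y₁) v∈₂
    ... | inj₁ v∈X₁ | inj₁ v∈X─ = x∈p─q⇒x∉q X X₁ v∈X─ v∈X₁
    ... | inj₁ v∈X₁ | inj₂ v∈Y─ = disj (X₁⊆X v∈X₁) (p─q⊆p Y Y₁ v∈Y─)
    ... | inj₂ v∈Y₁ | inj₁ v∈X─ = disj (p─q⊆p X X₁ v∈X─) (Y₁⊆Y v∈Y₁)
    ... | inj₂ v∈Y₁ | inj₂ v∈Y─ = x∈p─q⇒x∉q Y Y₁ v∈Y─ v∈Y₁

    cover : X ∪ Y ⊆ (X₁ ∪ Y₁) ∪ ((X ─ X₁) ∪ (Y ─ Y₁))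
    cover = p⊆r∧q⊆r⇒p∪q⊆r
      (p⊆r∧q⊆r⇒p∪q⊆r (q⊆p∪q (X₁ ∪ Y₁) _ ∘ p⊆p∪q (Y ─ Y₁)) (p⊆p∪q _ ∘ p⊆p∪q Y₁) ∘ p⊆p─q∪q X X₁)
      (p⊆r∧q⊆r⇒p∪q⊆r (q⊆p∪q (X₁ ∪ Y₁) _ ∘ q⊆p∪q (X ─ X₁) _) (p⊆p∪q _ ∘ q⊆p∪q X₁ Y₁) ∘ p⊆p─q∪q Y Y₁)

  -- Hall's marriage theorem.

  HallCondition : Subset n → Subset n → Set
  HallCondition X Y = ∀ S → S ⊆ X → ∣ S ∣ ≤ ∣ N S ∩ Y ∣

  -- Neighbours of a subset of `S` are already neighbours of `S`, so cutting `Y` down to `N S ∩ Y`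
  -- loses none of them.
  hall-restrict : ∀ {X Y S} → S ⊆ X → HallCondition X Y → HallCondition S (N S ∩ Y)
  hall-restrict {Y = Y} {S} S⊆X hall U U⊆S = ≤-trans (hall U (S⊆X ∘ U⊆S)) (p⊆q⇒∣p∣≤∣q∣ λ v∈ →
    let v∈NU , v∈Y = x∈p∩q⁻ (N U) Y v∈
    in x∈p∩q⁺ (v∈NU , x∈p∩q⁺ (N-mono U⊆S v∈NU , v∈Y)))

  -- Apply Hall's condition to `U ∪ S`. Its neighbours in `Y` lie in `N S ∩ Y` or are neighbours of
  -- `U` outside that set. By tightness the former account for at most `∣ S ∣`, so the latter number
  -- at least `∣ U ∣`.
  hall-difference : ∀ {X Y S} → S ⊆ X → ∣ N S ∩ Y ∣ ≤ ∣ S ∣ →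
    HallCondition X Y → HallCondition (X ─ S) (Y ─ (N S ∩ Y))
  hall-difference {X} {Y} {S} S⊆X tight hall U U⊆X─S = +-cancelʳ-≤ ∣ S ∣ _ _ (begin
    ∣ U ∣ + ∣ S ∣                ≤⟨ Disjoint⇒∣p∣+∣q∣≤∣r∣ (x∈p─q⇒x∉q X S ∘ U⊆X─S) (p⊆p∪q S) (q⊆p∪q U S) ⟩
    ∣ U ∪ S ∣                    ≤⟨ hall (U ∪ S) (p⊆r∧q⊆r⇒p∪q⊆r (p─q⊆p X S ∘ U⊆X─S) S⊆X) ⟩
    ∣ N (U ∪ S) ∩ Y ∣            ≤⟨ r⊆p∪q⇒∣r∣≤∣p∣+∣q∣ (N U ∩ (Y ─ T)) T cover ⟩
    ∣ N U ∩ (Y ─ T) ∣ + ∣ T ∣    ≤⟨ +-monoʳ-≤ _ tight ⟩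
    ∣ N U ∩ (Y ─ T) ∣ + ∣ S ∣    ∎)
    where
    open ≤-Reasoning
    T = N S ∩ Y
    cover : N (U ∪ S) ∩ Y ⊆ (N U ∩ (Y ─ T)) ∪ T
    cover {v} v∈ with x∈p∩q⁻ (N (U ∪ S)) Y v∈ | v ∈? T
    ... | v∈N , v∈Y | yes v∈T = x∈p∪q⁺ (inj₂ v∈T)
    ... | v∈N , v∈Y | no v∉T with ∈-N⁻ v∈N
    ... | u , u∈ , u~v with x∈p∪q⁻ U S u∈
    ... | inj₁ u∈U = x∈p∪q⁺ (inj₁ (x∈p∩q⁺ (∈-N⁺ u∈U u~v , x∈p∧x∉q⇒x∈p─q v∈Y v∉T)))
    ... | inj₂ u∈S = contradiction (x∈p∩q⁺ (∈-N⁺ u∈S u~v , v∈Y)) v∉T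

  -- Halmos and Vaughan: split along a tight set S, or, if there is none, remove
  -- any edge.
  hall⇒matching : ∀ k {X Y} → ∣ X ∣ ≤ k → Disjoint X Y → ∣ Y ∣ ≤ ∣ X ∣ →
    HallCondition X Y → PerfectMatchingOn (X ∪ Y)
  hall⇒matching k {X} {Y} ∣X∣≤k disj ∣Y∣≤∣X∣ hall with nonempty? X
  -- `∣ Y ∣ ≤ ∣ X ∣` makes `Y` empty as well.
  ... | no X-empty = emptyMatching λ (v , v∈) →
    [ (λ v∈X → X-empty (v , v∈X))
    , (λ v∈Y → <⇒≱ (x∈p⇒∣p-x∣<∣p∣ v∈Y)
        (≤-trans ∣Y∣≤∣X∣ (≤-trans (≤-reflexive (Empty⇒∣p∣≡0 X-empty)) z≤n)))
    ] (x∈p∪q⁻ X Y v∈)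
  hall⇒matching zero ∣X∣≤0 _ _ _ | yes (x , x∈X) =
    contradiction (≤-trans ∣X∣≤0 z≤n) (<⇒≱ (x∈p⇒∣p-x∣<∣p∣ x∈X))
  hall⇒matching (suc k) {X} {Y} ∣X∣≤1+k disj ∣Y∣≤∣X∣ hall | yes (x , x∈X)
    -- Exhaustive search makes the case split constructive. A nonempty proper `S` leaves two
    -- strictly smaller problems; under Hall's condition the last inequality is an equality.
    with anySubset? (λ S →
      S ⊆? X ×-dec nonempty? S ×-dec (∣ S ∣ <? ∣ X ∣) ×-dec (∣ N S ∩ Y ∣ ≤? ∣ S ∣))
  ... | yes (S , S⊆X , (s , s∈S) , ∣S∣<∣X∣ , tight) =
    glueDifferences disj S⊆X (p∩q⊆q (N S) Y)
      (hall⇒matching k (≤-pred (≤-trans ∣S∣<∣X∣ ∣X∣≤1+k))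
        (λ v∈S v∈T → disj (S⊆X v∈S) (p∩q⊆q (N S) Y v∈T)) tight (hall-restrict S⊆X hall))
      (hall⇒matching k
        (≤-pred (≤-trans (p∩q≢∅⇒∣p─q∣<∣p∣ X S (s , x∈p∩q⁺ (S⊆X s∈S , s∈S))) ∣X∣≤1+k))
        (λ v∈X v∈Y → disj (p─q⊆p X S v∈X) (p─q⊆p Y T v∈Y))
        -- Hall's condition at `S` gives `∣ S ∣ ≤ ∣ T ∣`, so `Y` loses at least as many vertices as
        -- `X`.
        (+-cancelʳ-≤ ∣ T ∣ _ _ (begin
          ∣ Y ─ T ∣ + ∣ T ∣ ≤⟨ q⊆p⇒∣p─q∣+∣q∣≤∣p∣ (p∩q⊆q (N S) Y) ⟩
          ∣ Y ∣             ≤⟨ ∣Y∣≤∣X∣ ⟩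
          ∣ X ∣             ≤⟨ ∣p∣≤∣p─q∣+∣q∣ X S ⟩
          ∣ X ─ S ∣ + ∣ S ∣ ≤⟨ +-monoʳ-≤ _ (hall S S⊆X) ⟩
          ∣ X ─ S ∣ + ∣ T ∣ ∎))
        (hall-difference S⊆X tight hall))
    where
    open ≤-Reasoning
    T = N S ∩ Y
  -- Hall's condition for the singleton of `x` supplies the edge to remove.
  ... | no ¬tight with 0<∣p∣⇒Nonempty
    (≤-trans (≤-reflexive (sym (∣⁅x⁆∣≡1 x))) (hall ⁅ x ⁆ (x∈p⇒⁅x⁆⊆p x∈X)))
  ... | y , y∈ with x∈p∩q⁻ (N ⁅ x ⁆) Y y∈
  ... | y∈N , y∈Y with ∈-N⁻ y∈N
  ... | x′ , x′∈ , x′~y =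
    glueDifferences disj (x∈p⇒⁅x⁆⊆p x∈X) (x∈p⇒⁅x⁆⊆p y∈Y)
      (edgeMatching (subst (_~ y) (x∈⁅y⁆⇒x≡y x x′∈) x′~y))
      (hall⇒matching k (≤-pred (≤-trans (x∈p⇒∣p-x∣<∣p∣ x∈X) ∣X∣≤1+k))
        (λ v∈X v∈Y → disj (p─q⊆p X ⁅ x ⁆ v∈X) (p─q⊆p Y ⁅ y ⁆ v∈Y))
        (+-cancelʳ-≤ 1 _ _ (begin
          ∣ Y - y ∣ + 1         ≡⟨ cong (∣ Y - y ∣ +_) (∣⁅x⁆∣≡1 y) ⟨
          ∣ Y - y ∣ + ∣ ⁅ y ⁆ ∣ ≤⟨ q⊆p⇒∣p─q∣+∣q∣≤∣p∣ (x∈p⇒⁅x⁆⊆p y∈Y) ⟩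
          ∣ Y ∣                 ≤⟨ ∣Y∣≤∣X∣ ⟩
          ∣ X ∣                 ≤⟨ ∣p∣≤∣p─q∣+∣q∣ X ⁅ x ⁆ ⟩
          ∣ X - x ∣ + ∣ ⁅ x ⁆ ∣ ≡⟨ cong (∣ X - x ∣ +_) (∣⁅x⁆∣≡1 x) ⟩
          ∣ X - x ∣ + 1         ∎))
        hall′)
    where
    open ≤-Reasoning
    hall′ : HallCondition (X - x) (Y - y)
    hall′ U U⊆X-x with nonempty? U
    -- The search covered only nonempty sets, so the empty one is handled apart.
    ... | no U-empty = ≤-trans (≤-reflexive (Empty⇒∣p∣≡0 U-empty)) z≤n
    ... | yes U-nonempty = +-cancelʳ-≤ 1 _ _ (begin
      ∣ U ∣ + 1                     ≡⟨ +-comm ∣ U ∣ 1 ⟩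
      -- `U` misses `x`, so it is a candidate of the failed search and its Hall inequality is
      -- strict; the spare neighbour makes up for the loss of `y`.
      suc ∣ U ∣                     ≤⟨ ≰⇒> (λ tight → ¬tight
                                         (U , p─q⊆p X ⁅ x ⁆ ∘ U⊆X-x , U-nonempty , ∣U∣<∣X∣ , tight)) ⟩
      ∣ N U ∩ Y ∣                   ≤⟨ r⊆p∪q⇒∣r∣≤∣p∣+∣q∣ (N U ∩ (Y - y)) ⁅ y ⁆ cover ⟩
      ∣ N U ∩ (Y - y) ∣ + ∣ ⁅ y ⁆ ∣ ≡⟨ cong (∣ N U ∩ (Y - y) ∣ +_) (∣⁅x⁆∣≡1 y) ⟩
      ∣ N U ∩ (Y - y) ∣ + 1         ∎)
      where
      ∣U∣<∣X∣ : ∣ U ∣ < ∣ X ∣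
      ∣U∣<∣X∣ = ≤-<-trans (p⊆q⇒∣p∣≤∣q∣ U⊆X-x) (x∈p⇒∣p-x∣<∣p∣ x∈X)
      cover : N U ∩ Y ⊆ (N U ∩ (Y - y)) ∪ ⁅ y ⁆
      cover v∈ with x∈p∩q⁻ (N U) Y v∈
      ... | v∈N , v∈Y with x∈p∪q⁻ (Y - y) ⁅ y ⁆ (p⊆p─q∪q Y ⁅ y ⁆ v∈Y)
      ... | inj₁ v∈Y-y = x∈p∪q⁺ (inj₁ (x∈p∩q⁺ (v∈N , v∈Y-y)))
      ... | inj₂ v∈y   = x∈p∪q⁺ (inj₂ v∈y)

  -- Colour classes as dominating sets.

  Independent : Subset n → Set
  Independent A = ∀ {u v} → u ∈ A → v ∈ A → ¬ (u ~ v)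

  bipartite⇒independentClasses : Bipartite G → ∃[ A ] (Independent A × Independent (∁ A))
  bipartite⇒independentClasses (c , proper) = tabulate c ,
    (λ u∈ v∈ u~v → proper u~v (trans (∈⇒true u∈) (sym (∈⇒true v∈)))) ,
    (λ u∈ v∈ u~v → proper u~v (trans (∈∁⇒false u∈) (sym (∈∁⇒false v∈))))
    where
    ∈⇒true : ∀ {v} → v ∈ tabulate c → c v ≡ true
    ∈⇒true {v} v∈ = trans (sym (lookup∘tabulate c v)) ([]=⇒lookup v∈)

    ∈∁⇒false : ∀ {v} → v ∈ ∁ (tabulate c) → c v ≡ false
    ∈∁⇒false {v} v∈ = ¬-not λ cv≡true →
      x∈∁p⇒x∉p v∈ (lookup⇒[]= v _ (trans (lookup∘tabulate c v) cv≡true))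

  -- Lets `∁-independent⇒dominating` be applied to `∁ A`, where it asks for independence of the
  -- double complement.
  independent⇒∁∁-independent : ∀ {A} → Independent A → Independent (∁ (∁ A))
  independent⇒∁∁-independent ind u∈ v∈ =
    ind (x∉∁p⇒x∈p (x∈∁p⇒x∉p u∈)) (x∉∁p⇒x∈p (x∈∁p⇒x∉p v∈))

  module _ (noIsolated : NoIsolatedVertices G) where

    ∁-independent⇒dominating : ∀ {A} → Independent (∁ A) → Dominating G A
    ∁-independent⇒dominating {A} ind v v∉A =
      let u , v~u = noIsolated v
      in u , x∉∁p⇒x∈p (λ u∈∁A → ind (x∉p⇒x∈∁p v∉A) u∈∁A v~u) , ~-sym v~u

    -- Trading `S` for its neighbours keeps the set dominating, so by minimality it cannot shrink:
    -- `S` has at least `∣ S ∣` neighbours.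
    minimumClass⇒hall : ∀ {A} → Independent A → Independent (∁ A) →
      (∀ D → Dominating G D → ∣ A ∣ ≤ ∣ D ∣) → HallCondition A (∁ A)
    minimumClass⇒hall {A} indA ind∁A minimum S S⊆A = +-cancelˡ-≤ ∣ A ─ S ∣ _ _ (begin
      ∣ A ─ S ∣ + ∣ S ∣         ≤⟨ q⊆p⇒∣p─q∣+∣q∣≤∣p∣ S⊆A ⟩
      ∣ A ∣                     ≤⟨ minimum _ dominating ⟩
      ∣ (A ─ S) ∪ (N S ∩ ∁ A) ∣ ≤⟨ ∣p∪q∣≤∣p∣+∣q∣ (A ─ S) (N S ∩ ∁ A) ⟩
      ∣ A ─ S ∣ + ∣ N S ∩ ∁ A ∣ ∎)
      where
      open ≤-Reasoning
      dominating : Dominating G ((A ─ S) ∪ (N S ∩ ∁ A))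
      dominating v v∉ with noIsolated v
      ... | u , v~u with v ∈? A | v ∈? S
      ... | yes v∈A | yes v∈S =
        u , x∈p∪q⁺ (inj₂ (x∈p∩q⁺ (∈-N⁺ v∈S v~u , x∉p⇒x∈∁p λ u∈A → indA v∈A u∈A v~u))) , ~-sym v~u
      ... | yes v∈A | no v∉S = contradiction (x∈p∪q⁺ (inj₁ (x∈p∧x∉q⇒x∈p─q v∈A v∉S))) v∉
      ... | no v∉A | _ =
        u , x∈p∪q⁺ (inj₁ (x∈p∧x∉q⇒x∈p─q u∈A u∉S)) , ~-sym v~u
        where
        u∈A : u ∈ A
        u∈A = x∉∁p⇒x∈p λ u∈∁A → ind∁A (x∉p⇒x∈∁p v∉A) u∈∁A v~u
        u∉S : u ∉ S
        -- A neighbour in `S` would put `v` itself among the vertices traded in.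
        u∉S u∈S = v∉ (x∈p∪q⁺ (inj₂ (x∈p∩q⁺ (∈-N⁺ u∈S (~-sym v~u) , x∉p⇒x∈∁p v∉A))))

  -- Defence along a perfect matching.

  matching⇒eternalDominating : ∀ {A} → Independent (∁ A) →
    PerfectMatchingOn (A ∪ ∁ A) → EternalDominating G A
  matching⇒eternalDominating {A} ind M = σ , λ rs legal →
    let inv = partner-guarded rs legal
    in (λ v v∉D → f v , inv v v∉D , f~ v) , (λ r r∉D → inv r r∉D , f~ r)
    where
    f : Fin n → Fin n
    f = partner M

    v∈A∪∁A : ∀ v → v ∈ A ∪ ∁ A
    v∈A∪∁A v = subst (v ∈_) (sym (p∪∁p≡⊤ A)) ∈⊤

    f~ : ∀ v → f v ~ v
    f~ v = adjacent M (v∈A∪∁A v)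

    ff≡ : ∀ v → f (f v) ≡ v
    ff≡ v = involutive M (v∈A∪∁A v)

    σ : Strategy G
    σ _ = f

    -- The invariant of the defence: every matching edge has a guarded end. It yields both
    -- domination and a legal response to each attack.
    partner-guarded : ∀ rs → LegalAttacks G A σ rs →
      ∀ v → v ∉ position G A σ rs → f v ∈ position G A σ rs
    partner-guarded [] _ v v∉A =
      x∉∁p⇒x∈p λ fv∈∁A → ind fv∈∁A (x∉p⇒x∈∁p v∉A) (f~ v)
    -- Only `r` and `f r` change. If `v` is `f r`, its partner `r` is now guarded. Otherwise `v` was
    -- empty before, so its partner had a guard, which has left only if `v` is `r`; but `r` is now
    -- occupied.
    partner-guarded (r ∷ rs) (legal , r∉D) v v∉D′ with v ≟ f r
    ... | yes refl = x∈p∪q⁺ (inj₂ (subst (_∈ ⁅ r ⁆) (sym (ff≡ r)) (x∈⁅x⁆ r)))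
    ... | no v≢fr = x∈p∪q⁺ (inj₁ (x∈p∧x≢y⇒x∈p-y
      (partner-guarded rs legal v λ v∈D → v∉D′ (x∈p∪q⁺ (inj₁ (x∈p∧x≢y⇒x∈p-y v∈D v≢fr))))
      λ fv≡fr → v∉D′ (x∈p∪q⁺ (inj₂ (subst (_∈ ⁅ r ⁆)
        (trans (sym (ff≡ r)) (trans (cong f (sym fv≡fr)) (ff≡ v))) (x∈⁅x⁆ r))))))

  eternalDominating⇒dominating : ∀ {D} → EternalDominating G D → Dominating G D
  eternalDominating⇒dominating (σ , wins) = proj₁ (wins [] tt)

  -- Attacks on an independent set.

  module _ {A D₁ : Subset n} (ind : Independent A) (eternal : EternalDominating G D₁) where

    private
      σ = proj₁ eternal
      wins = proj₂ eternal

      pos : List (Fin n) → Subset n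
      pos = position G D₁ σ

    -- Each attack adds one vertex, and a legal response vacates a vertex that really was occupied.
    ∣position∣≤ : ∀ rs → LegalAttacks G D₁ σ rs → ∣ pos rs ∣ ≤ ∣ D₁ ∣
    ∣position∣≤ [] _ = ≤-refl
    ∣position∣≤ (r ∷ rs) (legal , r∉D) = begin
      ∣ (D - v) ∪ ⁅ r ⁆ ∣   ≤⟨ ∣p∪q∣≤∣p∣+∣q∣ (D - v) ⁅ r ⁆ ⟩
      ∣ D - v ∣ + ∣ ⁅ r ⁆ ∣ ≡⟨ cong (∣ D - v ∣ +_) (∣⁅x⁆∣≡1 r) ⟩
      ∣ D - v ∣ + 1         ≡⟨ +-comm ∣ D - v ∣ 1 ⟩
      suc ∣ D - v ∣         ≤⟨ x∈p⇒∣p-x∣<∣p∣ (proj₁ (proj₂ (wins rs legal) r r∉D)) ⟩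
      ∣ D ∣                 ≤⟨ ∣position∣≤ rs legal ⟩
      ∣ D₁ ∣                ∎
      where
      open ≤-Reasoning
      D = pos rs
      v = σ rs r

    -- Go through the list, skipping vertices outside `A` and, to keep the attacks legal, those
    -- already guarded. Vertices of `A` guarded earlier remain so.
    attackAll : ∀ as → ∃[ rs ] (LegalAttacks G D₁ σ rs × (∀ {a} → a ∈ˡ as → a ∈ A → a ∈ pos rs))
    attackAll [] = [] , tt , λ ()
    attackAll (a ∷ as) with attackAll as
    ... | rs , legal , guarded with a ∈? pos rs | a ∈? A
    ... | yes a∈D | _ = rs , legal , λ { (here refl) _ → a∈D ; (there b∈) → guarded b∈ }
    ... | no a∉D | no a∉A =
      rs , legal , λ { (here refl) a∈A → contradiction a∈A a∉A ; (there b∈) → guarded b∈ }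
    ... | no a∉D | yes a∈A = a ∷ rs , (legal , a∉D) , λ
      { (here refl) _ → x∈p∪q⁺ (inj₂ (x∈⁅x⁆ a))
      ; (there b∈) b∈A → x∈p∪q⁺ (inj₁ (x∈p∧x≢y⇒x∈p-y (guarded b∈ b∈A)
          -- The moving guard comes from a neighbour of `a`, so it cannot stand on a vertex `b` of
          -- the independent set `A`.
          λ { refl → ind b∈A a∈A (proj₂ (proj₂ (wins rs legal) a a∉D)) }))
      }

    ∣independent∣≤∣eternalDominating∣ : ∣ A ∣ ≤ ∣ D₁ ∣
    ∣independent∣≤∣eternalDominating∣ =
      let rs , legal , guarded = attackAll (allFin n)
      in ≤-trans (p⊆q⇒∣p∣≤∣q∣ (guarded (∈-allFin _))) (∣position∣≤ rs legal)

proposition4p2 : ∀ (n : ℕ) (G : Graph n) → Bipartite G → NoIsolatedVertices G →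
    ∀ (γ γ∞ : ℕ) → IsDominationNumber G γ → IsEternalDominationNumber G γ∞ →
    (γ ≡ γ∞) ⇔ (2 * γ ≡ n)
proposition4p2 n G bipartite noIsolated γ γ∞ (_ , γ-minimum) ((E , E-eternal , ∣E∣≡γ∞) , γ∞-minimum)
  with bipartite⇒independentClasses G bipartite
... | A , indA , ind∁A = mk⇔ equal⇒half half⇒equal
  where
  B = ∁ A

  ∣A∣+∣B∣≡n : ∣ A ∣ + ∣ B ∣ ≡ n
  ∣A∣+∣B∣≡n = trans (cong (∣ A ∣ +_) (∣∁p∣≡n∸∣p∣ A)) (m+[n∸m]≡n (∣p∣≤n A))

  γ≤∣A∣ : γ ≤ ∣ A ∣
  γ≤∣A∣ = γ-minimum A (∁-independent⇒dominating G noIsolated ind∁A)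

  γ≤∣B∣ : γ ≤ ∣ B ∣
  γ≤∣B∣ = γ-minimum B (∁-independent⇒dominating G noIsolated (independent⇒∁∁-independent G indA))

  2γ≡γ+γ : 2 * γ ≡ γ + γ
  2γ≡γ+γ = cong (γ +_) (+-identityʳ γ)

  equal⇒half : γ ≡ γ∞ → 2 * γ ≡ n
  equal⇒half γ≡γ∞ = trans 2γ≡γ+γ (trans (cong₂ _+_ (γ≡ indA γ≤∣A∣) (γ≡ ind∁A γ≤∣B∣)) ∣A∣+∣B∣≡n)
    where
    γ≡ : ∀ {C} → Independent G C → γ ≤ ∣ C ∣ → γ ≡ ∣ C ∣
    -- The squeeze is `γ ≤ ∣ C ∣ ≤ ∣ E ∣ = γ∞ = γ`.
    γ≡ ind γ≤∣C∣ = ≤-antisym γ≤∣C∣ (≤-trans (∣independent∣≤∣eternalDominating∣ G ind E-eternal)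
      (≤-reflexive (trans ∣E∣≡γ∞ (sym γ≡γ∞))))

  half⇒equal : 2 * γ ≡ n → γ ≡ γ∞
  half⇒equal 2γ≡n = ≤-antisym
    (≤-trans (γ-minimum E (eternalDominating⇒dominating G E-eternal)) (≤-reflexive ∣E∣≡γ∞))
    (≤-trans (γ∞-minimum A A-eternal) ∣A∣≤γ)
    where
    open ≤-Reasoning

    ∣A∣+∣B∣≡γ+γ : ∣ A ∣ + ∣ B ∣ ≡ γ + γ
    ∣A∣+∣B∣≡γ+γ = trans ∣A∣+∣B∣≡n (trans (sym 2γ≡n) 2γ≡γ+γ)

    ∣A∣≤γ : ∣ A ∣ ≤ γ
    -- `B` takes at least `γ` of the `γ + γ` vertices, leaving at most `γ` for `A`.
    ∣A∣≤γ = +-cancelʳ-≤ γ _ _ (≤-trans (+-monoʳ-≤ ∣ A ∣ γ≤∣B∣) (≤-reflexive ∣A∣+∣B∣≡γ+γ))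

    ∣B∣≤∣A∣ : ∣ B ∣ ≤ ∣ A ∣
    ∣B∣≤∣A∣ = +-cancelˡ-≤ γ _ _ (begin
      γ + ∣ B ∣     ≤⟨ +-monoˡ-≤ ∣ B ∣ γ≤∣A∣ ⟩
      ∣ A ∣ + ∣ B ∣ ≡⟨ ∣A∣+∣B∣≡γ+γ ⟩
      γ + γ         ≤⟨ +-monoʳ-≤ γ γ≤∣A∣ ⟩
      γ + ∣ A ∣     ∎)

    A-eternal : EternalDominating G A
    -- `A` is now a minimum dominating set, which gives Hall's condition, and `∣B∣≤∣A∣` makes the
    -- matching exhaust `B` too.
    A-eternal = matching⇒eternalDominating G ind∁A
      (hall⇒matching G ∣ A ∣ ≤-refl x∈p⇒x∉∁p ∣B∣≤∣A∣
        (minimumClass⇒hall G noIsolated indA ind∁A λ D dom → ≤-trans ∣A∣≤γ (γ-minimum D dom)))
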